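{- Let $s\in\mathcal S(n+1)$ for some $n\in\omega$ and let $M_0,\dots,M_{\ell(s)-1}$ be uniform chains of rank $\omega$ such that (a) $\mathrm f M_i\cong\mathrm f M_j$ for all $i,j<\ell(s)$, and (b) $M_i\cong M_j$ whenever $i,j<\ell(s)$ and $\mathrm{wt}^s(i)=\mathrm{wt}^s(j)$. Then the chain $A=\mathcal A(s)[M_0,\dots,M_{\ell(s)-1}]$ is uniform, and its tail satisfies $$\mathrm f\bigl(\mathcal A(s)[M_0,\dots,M_{\ell(s)-1}]\bigr)\cong\mathcal A(\mathrm f s)\bigl[\mathrm f_s(M_0,\dots,M_{\ell(s)-1})\bigr].$$
   Context: A chain is a linearly ordered set; $\cong$ is order isomorphism. $A+B$ and $\sum_{i\in I}A_i$ are ordered sums, $AB=\sum_{b\in B}A$ is the anti-lexicographically ordered product; $\mathbb N,\mathbb Z$ have their usual orders and $1$ is the one-element chain. For a chain $A$ define convex equivalence relations $\rho_\alpha$ ($\alpha$ an ordinal): $\rho_0$ is equality; $A/\alpha$ is the quotient chain of $\rho_\alpha$-classes and $[x]_\alpha$ is the class of $x$; $x\rho_{\alpha+1}y$ iff the interval between $[x]_\alpha$ and $[y]_\alpha$ in $A/\alpha$ is finite; for limit $\alpha$, $x\rho_\alpha y$ iff $x\rho_\beta y$ for some $\beta<\alpha$. The rank $\mathrm{rk}(A)$ is the least $\alpha$ with $A/\alpha\cong 1$. All chains are assumed decomposable (their rank is defined). $A$ is uniform if $A^{\ge x}=\{y\in A:x\le y\}$ has the same order type for all $x\in A$; then $\mathrm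 f A$ denotes this common tail. $\mathcal S(m)$ is the set of sequences $s=(s(0),\dots,s(m-1))$ of natural numbers with $s(i)\le i$ for all $i<m$; $|s|=m$. For $s$ of length $n+1\ge2$: $s^-$ is $s$ with its last entry deleted, and $s^+$ is $s$ with its next-to-last entry $s(n-1)$ deleted; $s^+\in\mathcal S(n)$ iff $s(n)<n$. $\mathrm f s$ is the sequence obtained from $s$ by replacing its last entry with $0$. The tree of $s$ (nonempty) has root $(s;0)$; a node $(t;k)$ with $|t|=m+1\ge 2$ has the single child $(t^-;0)$ if $t(m)=m$, and a left child $(t^+;k+1)$ and a right child $(t^-;0)$ if $t(m)<m$. The leaves are the nodes $(\langle 0\rangle;k)$ on level $|s|-1$, ordered from left to right; $\ell(s)$ is their number and $\mathrm{wt}^s(i)=k$ if the $i$th leaf ($0\le i<\ell(s)$) is $(\langle0\rangle;k)$. For uniform chains $M_i$ of rank $\omega$: $\mathcal A(\langle0\rangle)[M_0]=M_0$, and for $s$ of length $n+1\ge 2$, $\mathcal A(s)[M_0,\dots,M_{\ell(s)-1}]=\mathcal A(s^-)[M_0,\dots,M_{\ell(s^-)-1}]\,\mathbb Z$ if $s(n)=n$ (then $\ell(s)=\ell(s^-)$), and $=\mathcal A(s^+)[M_0,\dots,M_{\ell(s^+)-1}]+\mathcal A(s^-)[M_{\ell(s^+)},\dots,M_{\ell(s)-1}]\,\mathbb N$ if $s(n)<n$ (then $\ell(s)=\ell(s^+)+\ell(s^-)$). Tail arrays: $\mathrm f_{\langle0\rangle}(M_0)=(\mathrm f M_0)$; for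 $s$ of length $n+1\ge2$, $\mathrm f_s(M_0,\dots,M_{\ell(s)-1})$ is the concatenation of $\mathrm f_{s^+}(M_0,\dots,M_{\ell(s^+)-1})$ with $(M_{\ell(s^+)},\dots,M_{\ell(s)-1})$ if $s(n)<n$, and the concatenation of $\mathrm f_{s^- }(M_0,\dots,M_{\ell(s)-1})$ with $(M_0,\dots,M_{\ell(s)-1})$ if $s(n)=n$. -}

module Defs where

open import Data.Fin.Base using (Fin; zero; _↑ˡ_)
open import Data.Fin.Relation.Unary.Top using (view; ‵fromℕ; ‵inject₁)
open import Data.Integer.Properties using () renaming (≤-decTotalOrder to ℤ-chain)
open import Data.List.Base using (List; []; _∷_; _++_)
open import Data.List.Membership.Setoid using () renaming (_∈_ to _∋_∈_)
open import Data.List.Membership.Setoid.Properties using (∈-++⁺ˡ; ∈-++⁺ʳ)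
open import Data.List.Relation.Unary.Any using (here)
open import Data.Nat.Base using (ℕ; zero; suc; _+_; _⊔_; _≤′_; ≤′-refl; ≤′-step)
open import Data.Nat.Properties using (m≤m⊔n; m≤n⊔m; ≤⇒≤′) renaming (≤-decTotalOrder to ℕ-chain)
open import Data.Product.Base using (∃-syntax; _×_; _,_; proj₁)
open import Data.Product.Relation.Binary.Lex.NonStrict using (×-totalOrder)
open import Data.Sum.Base using (_⊎_; inj₁; inj₂; swap; map)
open import Data.Sum.Relation.Binary.LeftOrder using (⊎-<-totalOrder)
open import Data.Unit.Properties using () renaming (≡-decTotalOrder to ⊤-decTotalOrder)
open import Data.Vec.Functional using (Vector; take; drop) renaming (_++_ to _⌢_)
open import Function.Base using (_∘_)
open import Level using (0ℓ)
open import Relation.Binary.Bundles using (TotalOrder; DecTotalOrder)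
open import Relation.Binary.Core using (Rel)
open import Relation.Binary.Construct.On using () renaming (totalOrder to on-totalOrder)
open import Relation.Binary.Morphism.Structures using (IsOrderIsomorphism)
open import Relation.Binary.Structures using (IsEquivalence)
open import Relation.Nullary using (¬_)

Chain : Set₁
Chain = TotalOrder 0ℓ 0ℓ 0ℓ

infix 4 _≅_

record _≅_ (A B : Chain) : Set where
  private
    module A = TotalOrder A
    module B = TotalOrder B
  field
    to                 : A.Carrier → B.Carrier
    isOrderIsomorphism : IsOrderIsomorphism A._≈_ B._≈_ A._≤_ B._≤_ to

𝟙 : Chain
𝟙 = DecTotalOrder.totalOrder ⊤-decTotalOrder

infixl 6 _⊕_
infixl 7 _⊗_

_⊕_ : Chain → Chain → Chain
A ⊕ B = ⊎-<-totalOrder A B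

-- The anti-lexicographic product AB = ∑_{b ∈ B} A, a sum of B many copies of A.
-- The library's lexicographic product compares first components first, so
-- elements are pairs (b , a).  Only B = ℕ and B = ℤ are needed, and there
-- equality is decidable.
_⊗_ : Chain → DecTotalOrder 0ℓ 0ℓ 0ℓ → Chain
A ⊗ B = ×-totalOrder B A

-- A^{≥x}
tailAt : (A : Chain) → TotalOrder.Carrier A → Chain
tailAt A x = on-totalOrder A (proj₁ {B = λ y → TotalOrder._≤_ A x y})

-- Chains with a rank are nonempty.  The base point serves to pick out one of
-- the (pairwise isomorphic) tails as "the" tail 𝐟 A.
record Uniform (A : Chain) : Set where
  field
    base       : TotalOrder.Carrier A
    equalTails : ∀ x y → tailAt A x ≅ tailAt A y

𝐟 : {A : Chain} → Uniform A → Chain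
𝐟 {A} U = tailAt A (Uniform.base U)

------------------------------------------------------------------------
-- The condensations ρ_α for α ≤ ω, and rank ω

record ConvexEquivalence (A : Chain) : Set₁ where
  open TotalOrder A
  infix 4 _~_
  field
    _~_           : Rel Carrier 0ℓ
    isEquivalence : IsEquivalence _~_
    ≈⇒~           : ∀ {x y} → x ≈ y → x ~ y
    convex        : ∀ {x y z} → x ≤ y → y ≤ z → x ~ z → x ~ y

-- The elements of the quotient chain are those of A, its equality is the
-- equivalence: x stands for its class [x].
_/_ : (A : Chain) → ConvexEquivalence A → Chain
A / E = record
  { Carrier      = Carrier
  ; _≈_          = _~_
  ; _≤_          = λ x y → x ≤ y ⊎ x ~ y
  ; isTotalOrder = record
    { isPartialOrder = record
      { isPreorder = record
        { isEquivalence = E.isEquivalence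
        ; reflexive     = inj₂
        ; trans         = /-trans
        }
      ; antisym = /-antisym
      }
    ; total = /-total
    }
  }
  where
  open TotalOrder A using (Carrier; _≤_; trans; antisym; total)
  module E = ConvexEquivalence E
  open E using (_~_; convex)
  open IsEquivalence E.isEquivalence using ()
    renaming (sym to ~-sym; trans to ~-trans)

  /-trans : ∀ {x y z} → x ≤ y ⊎ x ~ y → y ≤ z ⊎ y ~ z → x ≤ z ⊎ x ~ z
  /-trans (inj₁ x≤y) (inj₁ y≤z) = inj₁ (trans x≤y y≤z)
  /-trans (inj₂ x~y) (inj₂ y~z) = inj₂ (~-trans x~y y~z)
  /-trans {x} {y} {z} (inj₁ x≤y) (inj₂ y~z) with total x z
  ... | inj₁ x≤z = inj₁ x≤z
  ... | inj₂ z≤x = inj₂ (~-sym (convex z≤x x≤y (~-sym y~z)))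
  /-trans {x} {y} {z} (inj₂ x~y) (inj₁ y≤z) with total x z
  ... | inj₁ x≤z = inj₁ x≤z
  ... | inj₂ z≤x = inj₂ (~-trans x~y (convex y≤z z≤x (~-sym x~y)))

  /-antisym : ∀ {x y} → x ≤ y ⊎ x ~ y → y ≤ x ⊎ y ~ x → x ~ y
  /-antisym (inj₂ x~y) _          = x~y
  /-antisym (inj₁ _)   (inj₂ y~x) = ~-sym y~x
  /-antisym (inj₁ x≤y) (inj₁ y≤x) = E.≈⇒~ (antisym x≤y y≤x)

  /-total : ∀ x y → (x ≤ y ⊎ x ~ y) ⊎ (y ≤ x ⊎ y ~ x)
  /-total x y = map inj₁ inj₁ (total x y)

Between : (A : Chain) (x y z : TotalOrder.Carrier A) → Set
Between A x y z = (x ≤ z × z ≤ y) ⊎ (y ≤ z × z ≤ x)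
  where open TotalOrder A

FiniteInterval : (A : Chain) (x y : TotalOrder.Carrier A) → Set
FiniteInterval A x y = ∃[ zs ] (∀ z → Between A x y z → Eq.setoid ∋ z ∈ zs)
  where open TotalOrder A

finiteCondensation : (A : Chain) → ConvexEquivalence A
finiteCondensation A = record
  { _~_           = FiniteInterval A
  ; isEquivalence = record
    { refl  = ≈⇒~ Eq.refl
    ; sym   = λ (zs , f) → zs , λ z → f z ∘ swap
    ; trans = ~-trans
    }
  ; ≈⇒~    = ≈⇒~
  ; convex = λ { x≤y y≤z (zs , f) → zs , λ
      { w (inj₁ (x≤w , w≤y)) → f w (inj₁ (x≤w , trans w≤y y≤z))
      ; w (inj₂ (y≤w , w≤x)) →
          f w (inj₁ (trans x≤y y≤w , trans w≤x (trans x≤y y≤z)))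
      } }
  }
  where
  open TotalOrder A

  ≈⇒~ : ∀ {x y} → x ≈ y → FiniteInterval A x y
  ≈⇒~ {x} x≈y = x ∷ [] , λ
    { w (inj₁ (x≤w , w≤y)) →
        here (antisym (trans w≤y (reflexive (Eq.sym x≈y))) x≤w)
    ; w (inj₂ (y≤w , w≤x)) →
        here (antisym w≤x (trans (reflexive x≈y) y≤w))
    }

  ~-trans : ∀ {x y z} → FiniteInterval A x y → FiniteInterval A y z →
            FiniteInterval A x z
  ~-trans {x} {y} {z} (us , f) (vs , g) = us ++ vs , cover
    where
    inUs : ∀ w → Between A x y w → Eq.setoid ∋ w ∈ (us ++ vs)
    inUs w p = ∈-++⁺ˡ Eq.setoid (f w p)
    inVs : ∀ w → Between A y z w → Eq.setoid ∋ w ∈ (us ++ vs)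
    inVs w p = ∈-++⁺ʳ Eq.setoid us (g w p)
    cover : ∀ w → Between A x z w → Eq.setoid ∋ w ∈ (us ++ vs)
    cover w p with total w y | p
    ... | inj₁ w≤y | inj₁ (x≤w , _) = inUs w (inj₁ (x≤w , w≤y))
    ... | inj₂ y≤w | inj₁ (_ , w≤z) = inVs w (inj₁ (y≤w , w≤z))
    ... | inj₁ w≤y | inj₂ (z≤w , _) = inVs w (inj₂ (z≤w , w≤y))
    ... | inj₂ y≤w | inj₂ (_ , w≤x) = inUs w (inj₂ (y≤w , w≤x))

equality : (A : Chain) → ConvexEquivalence A
equality A = record
  { _~_           = _≈_
  ; isEquivalence = isEquivalence
  ; ≈⇒~           = λ x≈y → x≈y
  ; convex        = λ x≤y y≤z x≈z → antisym x≤y (trans y≤z (reflexive (Eq.sym x≈z)))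
  }
  where open TotalOrder A

-- x ~ y iff the interval between [x] and [y] in A / E is finite.
condense : {A : Chain} → ConvexEquivalence A → ConvexEquivalence A
condense {A} E = record
  { _~_           = F._~_
  ; isEquivalence = F.isEquivalence
  ; ≈⇒~           = λ x≈y → F.≈⇒~ (ConvexEquivalence.≈⇒~ E x≈y)
  ; convex        = λ x≤y y≤z → F.convex (inj₁ x≤y) (inj₁ y≤z)
  }
  where module F = ConvexEquivalence (finiteCondensation (A / E))

ρ : (A : Chain) → ℕ → ConvexEquivalence A
ρ A zero    = equality A
ρ A (suc n) = condense (ρ A n)

ρω : (A : Chain) → ConvexEquivalence A
ρω A = record
  { _~_           = λ x y → ∃[ n ] ρ[ n ] x y
  ; isEquivalence = record
    { refl  = 0 , Eq.refl
    ; sym   = λ (n , p) → n , IsEquivalence.sym (ρ-equiv n) p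
    ; trans = λ { (m , p) (n , q) → m ⊔ n ,
        IsEquivalence.trans (ρ-equiv (m ⊔ n))
          (mono (≤⇒≤′ (m≤m⊔n m n)) p) (mono (≤⇒≤′ (m≤n⊔m m n)) q) }
    }
  ; ≈⇒~    = λ x≈y → 0 , x≈y
  ; convex = λ x≤y y≤z (n , p) → n , ConvexEquivalence.convex (ρ A n) x≤y y≤z p
  }
  where
  open TotalOrder A
  ρ[_] : ℕ → Rel Carrier 0ℓ
  ρ[ n ] = ConvexEquivalence._~_ (ρ A n)
  ρ-equiv : ∀ n → IsEquivalence ρ[ n ]
  ρ-equiv n = ConvexEquivalence.isEquivalence (ρ A n)
  mono : ∀ {m n x y} → m ≤′ n → ρ[ m ] x y → ρ[ n ] x y
  mono ≤′-refl p = p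
  mono {n = suc n} (≤′-step m≤n) p =
    ConvexEquivalence.≈⇒~ (finiteCondensation (A / ρ A n)) (mono m≤n p)

-- ω is the least α with A/α ≅ 1; the ordinals below ω are the natural numbers.
HasRankω : Chain → Set
HasRankω A = (A / ρω A ≅ 𝟙) × (∀ n → ¬ (A / ρ A n ≅ 𝟙))

------------------------------------------------------------------------
-- Sequences and their trees

-- 𝒮 m is the set of sequences s of length m with s(i) ≤ i, i.e. with
-- s(i) ∈ Fin (suc i).
infixl 5 _▹_

data 𝒮 : ℕ → Set where
  ⟨⟩  : 𝒮 0
  _▹_ : ∀ {m} → 𝒮 m → Fin (suc m) → 𝒮 (suc m)

-- For t = s ▹ a ▹ b of length n + 1, the view of b distinguishes b = n
-- (‵fromℕ) from b < n (‵inject₁ j, where j is b as an element of Fin n).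
-- Throughout, t⁻ = s ▹ a and, in the second case, t⁺ = s ▹ j.

-- ℓ s is the number of leaves of the tree of s, as the type of tree shows.
ℓ : ∀ {n} → 𝒮 (suc n) → ℕ
ℓ {zero} _ = 1
ℓ {suc n} (s ▹ a ▹ b) with view b
... | ‵fromℕ     = ℓ (s ▹ a)
... | ‵inject₁ j = ℓ (s ▹ j) + ℓ (s ▹ a)

-- Trees indexed by their number of leaves.  Only the label k of a leaf
-- (⟨0⟩;k) is recorded.
data Tree : ℕ → Set where
  leaf   : ℕ → Tree 1
  unary  : ∀ {l} → Tree l → Tree l
  binary : ∀ {l r} → Tree l → Tree r → Tree (l + r)

-- The subtree at the node (s;k).
tree : ∀ {n} (s : 𝒮 (suc n)) → ℕ → Tree (ℓ s)
tree {zero} _ k = leaf k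
tree {suc n} (s ▹ a ▹ b) k with view b
... | ‵fromℕ     = unary (tree (s ▹ a) 0)
... | ‵inject₁ j = binary (tree (s ▹ j) (suc k)) (tree (s ▹ a) 0)

leafLabels : ∀ {l} → Tree l → Vector ℕ l
leafLabels (leaf k)     = λ _ → k
leafLabels (unary t)    = leafLabels t
leafLabels (binary t u) = leafLabels t ⌢ leafLabels u

wt : ∀ {n} (s : 𝒮 (suc n)) → Vector ℕ (ℓ s)
wt s = leafLabels (tree s 0)

------------------------------------------------------------------------
-- The chains 𝒜(s)[M] and the tail arrays

𝒜 : ∀ {n} (s : 𝒮 (suc n)) → Vector Chain (ℓ s) → Chain
𝒜 {zero} _ M = M zero
𝒜 {suc n} (s ▹ a ▹ b) M with view b
... | ‵fromℕ     = 𝒜 (s ▹ a) M ⊗ ℤ-chain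
... | ‵inject₁ j = 𝒜 (s ▹ j) (take (ℓ (s ▹ j)) M)
                 ⊕ 𝒜 (s ▹ a) (drop (ℓ (s ▹ j)) M) ⊗ ℕ-chain

𝐟ˢ : ∀ {n} → 𝒮 (suc n) → 𝒮 (suc n)
𝐟ˢ (s ▹ _) = s ▹ zero

-- f_s(M).  Its length is right because 𝐟ˢ t⁺ (if b < n) and 𝐟ˢ t⁻ (if b = n)
-- are both s ▹ zero = (𝐟ˢ t)⁺, while t⁻ = (𝐟ˢ t)⁻.
tailArray : ∀ {n} (s : 𝒮 (suc n)) (M : Vector Chain (ℓ s)) →
            (∀ i → Uniform (M i)) → Vector Chain (ℓ (𝐟ˢ s))
tailArray {zero} (s ▹ _) M U = λ _ → 𝐟 (U zero)
tailArray {suc n} (s ▹ a ▹ b) M U with view b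
... | ‵fromℕ     = tailArray (s ▹ a) M U ⌢ M
... | ‵inject₁ j = tailArray (s ▹ j) (take (ℓ (s ▹ j)) M) (λ i → U (i ↑ˡ ℓ (s ▹ a)))
                 ⌢ drop (ℓ (s ▹ j)) M

{-# OPTIONS --safe #-}
module Submission where

-- Write t = s ▹ a ▹ b, so that t⁻ = s ▹ a and, if b < n, t⁺ = s ▹ b.  By
-- induction on the sequence, every tail of 𝒜 t M, and not just one of them, is
-- shown to be isomorphic to 𝒜 (𝐟ˢ t) (tailArray t M U) (tailAt-𝒜); uniformity
-- then follows.  If b < n, let M′ and M″ be the parts of M that belong to t⁺ and
-- t⁻.
--
-- A tail of 𝒜 t⁻ M ⊗ ℤ, or one of 𝒜 t⁺ M′ ⊕ 𝒜 t⁻ M″ ⊗ ℕ starting in the right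
-- summand, is a tail of 𝒜 t⁻ followed by ℕ many copies of 𝒜 t⁻ (tailAt-⊗ℤ,
-- tailAt-⊗ℕ).  A tail starting in the left summand is a tail of 𝒜 t⁺ followed
-- by those same copies.  Hence the one thing to compare is the tail of
-- 𝒜 t⁺ M′ with that of 𝒜 t⁻ M″.  By induction they are 𝒜 (s ▹ zero) of the two
-- tail arrays, because 𝐟ˢ t⁺ and 𝐟ˢ t⁻ are both s ▹ zero.  These arrays are
-- isomorphic entry by entry (tailArray-cong): each consists of the tail of the
-- leftmost chain and, for every node on the leftmost path, the chains at the
-- leaves below the right (or only) child of that node.  The former agree by (a).
-- The latter agree by (b): the subtree at that child is tree r 0 with the same
-- sequence r on both sides, so corresponding leaves have equal labels.
--
-- Passing to t⁺ raises the label at the root of the left subtree.  The induction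
-- therefore treats trees with an arbitrary label at the root, and hypothesis (b)
-- is phrased for two families at once (Coherent), so that it is inherited by
-- subtrees without comparing the labels of t with those of t⁺.

open import Defs
open import Data.Fin.Base using (Fin; zero; _↑ˡ_; _↑ʳ_; splitAt)
open import Data.Fin.Relation.Unary.Top using (view; ‵fromℕ; ‵inject₁)
open import Data.Integer.Base as ℤ using (+_; ∣_∣; 0ℤ)
open import Data.Integer.Properties as ℤₚ using () renaming (≤-decTotalOrder to ℤ-chain)
open import Data.Nat.Base as ℕ using (ℕ; zero; suc)
open import Data.Nat.Properties as ℕₚ using () renaming (≤-decTotalOrder to ℕ-chain)
open import Data.Product.Base using (Σ-syntax; _×_; _,_; proj₁; proj₂)
open import Data.Sum.Base using (inj₁; inj₂)
open import Data.Sum.Relation.Binary.LeftOrder using (₁∼₁; ₁∼₂; ₂∼₂)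
open import Data.Sum.Relation.Binary.Pointwise using (inj₁; inj₂)
open import Data.Vec.Functional using (Vector; take; drop) renaming (_++_ to _⌢_)
open import Data.Vec.Functional.Properties using (lookup-++ˡ; lookup-++ʳ)
open import Function.Base using (_∘_)
open import Level using (0ℓ)
open import Relation.Binary.Bundles using (TotalOrder; DecTotalOrder)
open import Relation.Binary.Construct.On using () renaming (decTotalOrder to on-decTotalOrder)
import Relation.Binary.Morphism.Construct.Composition as Composition
import Relation.Binary.Morphism.Construct.Identity as Identity
open import Relation.Binary.Morphism.Structures using (IsOrderIsomorphism)
open import Relation.Binary.PropositionalEquality
  using (_≡_; refl; sym; trans; cong; subst₂)
open import Relation.Nullary using (contradiction)

open TotalOrder using (Carrier)

-- Order isomorphisms

-- Monotone maps that are inverse to each other form an isomorphism.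
module _ {A B : Chain} where
  private
    module A = TotalOrder A
    module B = TotalOrder B

  mk≅ : (f : A.Carrier → B.Carrier) (g : B.Carrier → A.Carrier) →
        (∀ x y → x A.≤ y → f x B.≤ f y) → (∀ x y → x B.≤ y → g x A.≤ g y) →
        (∀ y → f (g y) B.≈ y) → (∀ x → g (f x) A.≈ x) → A ≅ B
  mk≅ f g f-mono g-mono fg gf = record
    { to                 = f
    ; isOrderIsomorphism = record
      { isOrderMonomorphism = record
        { isOrderHomomorphism = record { cong = f-cong ; mono = f-mono _ _ }
        ; injective           = λ fx≈fy →
            A.antisym (f-cancel (B.reflexive fx≈fy))
                      (f-cancel (B.reflexive (B.Eq.sym fx≈fy)))
        ; cancel              = f-cancel
        }
      ; surjective = λ y → g y , λ z≈gy → B.Eq.trans (f-cong z≈gy) (fg y)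
      }
    }
    where
    f-cong : ∀ {x y} → x A.≈ y → f x B.≈ f y
    f-cong x≈y = B.antisym (f-mono _ _ (A.reflexive x≈y))
                           (f-mono _ _ (A.reflexive (A.Eq.sym x≈y)))
    f-cancel : ∀ {x y} → f x B.≤ f y → x A.≤ y
    f-cancel {x} {y} fx≤fy =
      A.trans (A.reflexive (A.Eq.sym (gf x)))
        (A.trans (g-mono _ _ fx≤fy) (A.reflexive (gf y)))

-- An isomorphism with its inverse, which surjectivity provides.
module Iso {A B : Chain} (e : A ≅ B) where
  private
    module A = TotalOrder A
    module B = TotalOrder B
  open _≅_ e public
  open IsOrderIsomorphism isOrderIsomorphism public
    using (mono; cancel; injective; surjective) renaming (cong to to-cong)

  from : B.Carrier → A.Carrier
  from y = proj₁ (surjective y)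

  to-from : ∀ y → to (from y) B.≈ y
  to-from y = proj₂ (surjective y) A.Eq.refl

  from-to : ∀ x → from (to x) A.≈ x
  from-to x = injective (to-from (to x))

  from-mono : ∀ x y → x B.≤ y → from x A.≤ from y
  from-mono x y x≤y = cancel
    (B.trans (B.reflexive (to-from x))
      (B.trans x≤y (B.reflexive (B.Eq.sym (to-from y)))))

≅-refl : ∀ {A} → A ≅ A
≅-refl {A} = record
  { isOrderIsomorphism = Identity.isOrderIsomorphism _ _ (TotalOrder.Eq.refl A) }

≅-reflexive : ∀ {A B} → A ≡ B → A ≅ B
≅-reflexive refl = ≅-refl

≅-sym : ∀ {A B} → A ≅ B → B ≅ A
≅-sym e = mk≅ from to from-mono (λ _ _ → mono) from-to to-from
  where open Iso e

≅-trans : ∀ {A B C} → A ≅ B → B ≅ C → A ≅ C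
≅-trans {C = C} e f = record
  { isOrderIsomorphism = Composition.isOrderIsomorphism (TotalOrder.Eq.trans C)
      (_≅_.isOrderIsomorphism e) (_≅_.isOrderIsomorphism f) }

⊕-cong : ∀ {A A′ B B′} → A ≅ A′ → B ≅ B′ → A ⊕ B ≅ A′ ⊕ B′
⊕-cong {A} {A′} {B} {B′} e f = mk≅ (map⊕ e f) (map⊕ (≅-sym e) (≅-sym f))
  (map⊕-mono e f) (map⊕-mono (≅-sym e) (≅-sym f))
  (λ { (inj₁ x) → inj₁ (Iso.to-from e x) ; (inj₂ y) → inj₂ (Iso.to-from f y) })
  (λ { (inj₁ x) → inj₁ (Iso.from-to e x) ; (inj₂ y) → inj₂ (Iso.from-to f y) })
  where
  map⊕ : ∀ {A A′ B B′} → A ≅ A′ → B ≅ B′ → Carrier (A ⊕ B) → Carrier (A′ ⊕ B′)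
  map⊕ e f (inj₁ x) = inj₁ (Iso.to e x)
  map⊕ e f (inj₂ y) = inj₂ (Iso.to f y)

  map⊕-mono : ∀ {A A′ B B′} (e : A ≅ A′) (f : B ≅ B′) x y →
    TotalOrder._≤_ (A ⊕ B) x y → TotalOrder._≤_ (A′ ⊕ B′) (map⊕ e f x) (map⊕ e f y)
  map⊕-mono e f _ _ ₁∼₂       = ₁∼₂
  map⊕-mono e f _ _ (₁∼₁ x≤y) = ₁∼₁ (Iso.mono e x≤y)
  map⊕-mono e f _ _ (₂∼₂ x≤y) = ₂∼₂ (Iso.mono f x≤y)

⊗-cong : ∀ {A A′} B B′ → A ≅ A′ →
         DecTotalOrder.totalOrder B ≅ DecTotalOrder.totalOrder B′ → A ⊗ B ≅ A′ ⊗ B′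
⊗-cong B B′ e f = mk≅ (map⊗ B B′ e f) (map⊗ B′ B (≅-sym e) (≅-sym f))
  (map⊗-mono B B′ e f) (map⊗-mono B′ B (≅-sym e) (≅-sym f))
  (λ (b , a) → Iso.to-from f b , Iso.to-from e a)
  (λ (b , a) → Iso.from-to f b , Iso.from-to e a)
  where
  map⊗ : ∀ {A A′} B B′ → A ≅ A′ →
         DecTotalOrder.totalOrder B ≅ DecTotalOrder.totalOrder B′ →
         Carrier (A ⊗ B) → Carrier (A′ ⊗ B′)
  map⊗ _ _ e f (b , a) = Iso.to f b , Iso.to e a

  map⊗-mono : ∀ {A A′} B B′ (e : A ≅ A′)
    (f : DecTotalOrder.totalOrder B ≅ DecTotalOrder.totalOrder B′) x y →
    TotalOrder._≤_ (A ⊗ B) x y →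
    TotalOrder._≤_ (A′ ⊗ B′) (map⊗ B B′ e f x) (map⊗ B B′ e f y)
  map⊗-mono _ _ e f _ _ (inj₁ (b≤c , b≉c)) = inj₁ (Iso.mono f b≤c , b≉c ∘ Iso.injective f)
  map⊗-mono _ _ e f _ _ (inj₂ (b≈c , a≤d)) = inj₂ (Iso.to-cong f b≈c , Iso.mono e a≤d)

⊗-congˡ : ∀ {A A′} B → A ≅ A′ → A ⊗ B ≅ A′ ⊗ B
⊗-congˡ B e = ⊗-cong B B e ≅-refl

-- Tails of sums and products

tailAt-⊕ˡ : ∀ {A B} x → tailAt (A ⊕ B) (inj₁ x) ≅ tailAt A x ⊕ B
tailAt-⊕ˡ {A} {B} x = mk≅ f g f-mono g-mono
  (λ { (inj₁ _) → inj₁ A.Eq.refl ; (inj₂ _) → inj₂ B.Eq.refl })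
  (λ { (inj₁ _ , ₁∼₁ _) → inj₁ A.Eq.refl ; (inj₂ _ , ₁∼₂) → inj₂ B.Eq.refl })
  where
  module A = TotalOrder A
  module B = TotalOrder B
  T  = tailAt (A ⊕ B) (inj₁ x)
  T′ = tailAt A x ⊕ B

  f : Carrier T → Carrier T′
  f (inj₁ y , ₁∼₁ x≤y) = inj₁ (y , x≤y)
  f (inj₂ z , ₁∼₂)     = inj₂ z

  g : Carrier T′ → Carrier T
  g (inj₁ (y , x≤y)) = inj₁ y , ₁∼₁ x≤y
  g (inj₂ z)         = inj₂ z , ₁∼₂

  f-mono : ∀ y z → TotalOrder._≤_ T y z → TotalOrder._≤_ T′ (f y) (f z)
  f-mono (_ , ₁∼₁ _) (_ , ₁∼₁ _) (₁∼₁ p) = ₁∼₁ p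
  f-mono (_ , ₁∼₁ _) (_ , ₁∼₂)   ₁∼₂     = ₁∼₂
  f-mono (_ , ₁∼₂)   (_ , ₁∼₂)   (₂∼₂ p) = ₂∼₂ p

  g-mono : ∀ y z → TotalOrder._≤_ T′ y z → TotalOrder._≤_ T (g y) (g z)
  g-mono _ _ (₁∼₁ p) = ₁∼₁ p
  g-mono _ _ ₁∼₂     = ₁∼₂
  g-mono _ _ (₂∼₂ p) = ₂∼₂ p

tailAt-⊕ʳ : ∀ {A B} y → tailAt (A ⊕ B) (inj₂ y) ≅ tailAt B y
tailAt-⊕ʳ {A} {B} y = mk≅ f (λ (z , p) → inj₂ z , ₂∼₂ p) f-mono (λ _ _ → ₂∼₂)
  (λ _ → TotalOrder.Eq.refl B) (λ { (_ , ₂∼₂ _) → inj₂ (TotalOrder.Eq.refl B) })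
  where
  T = tailAt (A ⊕ B) (inj₂ y)

  f : Carrier T → Carrier (tailAt B y)
  f (inj₂ z , ₂∼₂ p) = z , p

  f-mono : ∀ u v → TotalOrder._≤_ T u v → TotalOrder._≤_ (tailAt B y) (f u) (f v)
  f-mono (_ , ₂∼₂ _) (_ , ₂∼₂ _) (₂∼₂ p) = p

-- B^{>b}.  The strict order c < d is c ≤ d together with c ≉ d, which is the
-- strict order that ⊗ uses to compare first components.
strictTailAt : (B : DecTotalOrder 0ℓ 0ℓ 0ℓ) → DecTotalOrder.Carrier B →
               DecTotalOrder 0ℓ 0ℓ 0ℓ
strictTailAt B b = on-decTotalOrder B (proj₁ {B = λ c → b ≤ c × b ≉ c})
  where open DecTotalOrder B using (_≤_; _≉_)

-- The copy of A at b contributes the tail of A; all later copies are complete.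
tailAt-⊗ : ∀ {A} B b a →
           tailAt (A ⊗ B) (b , a) ≅ tailAt A a ⊕ A ⊗ strictTailAt B b
tailAt-⊗ {A} B b a = mk≅ f g f-mono g-mono
  (λ { (inj₁ _) → inj₁ A.Eq.refl ; (inj₂ _) → inj₂ (B.Eq.refl , A.Eq.refl) })
  (λ { (_ , inj₁ _) → B.Eq.refl , A.Eq.refl ; (_ , inj₂ (b≈c , _)) → b≈c , A.Eq.refl })
  where
  module A = TotalOrder A
  module B = DecTotalOrder B
  T  = tailAt (A ⊗ B) (b , a)
  T′ = tailAt A a ⊕ A ⊗ strictTailAt B b

  f : Carrier T → Carrier T′
  f ((c , d) , inj₁ b<c)       = inj₂ ((c , b<c) , d)
  f ((c , d) , inj₂ (_ , a≤d)) = inj₁ (d , a≤d)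

  g : Carrier T′ → Carrier T
  g (inj₁ (d , a≤d))       = (b , d) , inj₂ (B.Eq.refl , a≤d)
  g (inj₂ ((c , b<c) , d)) = (c , d) , inj₁ b<c

  f-mono : ∀ y z → TotalOrder._≤_ T y z → TotalOrder._≤_ T′ (f y) (f z)
  f-mono (_ , inj₁ _) (_ , inj₁ _) p = ₂∼₂ p
  f-mono (_ , inj₂ _) (_ , inj₁ _) _ = ₁∼₂
  f-mono (_ , inj₁ (b≤c , b≉c)) (_ , inj₂ (b≈c′ , _)) p =
    contradiction (B.antisym b≤c (B.trans (c≤c′ p) (B.reflexive (B.Eq.sym b≈c′)))) b≉c
    where
    c≤c′ : ∀ {c c′ d d′} → TotalOrder._≤_ (A ⊗ B) (c , d) (c′ , d′) → c B.≤ c′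
    c≤c′ (inj₁ (c≤c′ , _)) = c≤c′
    c≤c′ (inj₂ (c≈c′ , _)) = B.reflexive c≈c′
  f-mono (_ , inj₂ _) (_ , inj₂ _) (inj₂ (_ , d≤d′)) = ₁∼₁ d≤d′
  f-mono (_ , inj₂ (b≈c , _)) (_ , inj₂ (b≈c′ , _)) (inj₁ (_ , c≉c′)) =
    contradiction (B.Eq.trans (B.Eq.sym b≈c) b≈c′) c≉c′

  g-mono : ∀ y z → TotalOrder._≤_ T′ y z → TotalOrder._≤_ T (g y) (g z)
  g-mono _ _ (₁∼₁ p)                           = inj₂ (B.Eq.refl , p)
  g-mono _ (inj₂ ((_ , b<c) , _)) ₁∼₂          = inj₁ b<c
  g-mono _ _ (₂∼₂ p)                           = p

strictTailAt-ℕ : ∀ m → DecTotalOrder.totalOrder (strictTailAt ℕ-chain m) ≅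
                       DecTotalOrder.totalOrder ℕ-chain
strictTailAt-ℕ m = mk≅ (λ (n , _) → n ℕ.∸ suc m)
  (λ k → suc m ℕ.+ k , ℕₚ.<⇒≤ (m<1+m+k k) , ℕₚ.<⇒≢ (m<1+m+k k))
  (λ _ _ → ℕₚ.∸-monoˡ-≤ (suc m)) (λ _ _ → ℕₚ.+-monoʳ-≤ (suc m))
  (ℕₚ.m+n∸m≡n (suc m))
  (λ (_ , m≤n , m≢n) → ℕₚ.m+[n∸m]≡n (ℕₚ.≤∧≢⇒< m≤n m≢n))
  where
  m<1+m+k : ∀ k → m ℕ.< suc m ℕ.+ k
  m<1+m+k = ℕₚ.m≤m+n (suc m)

strictTailAt-ℤ : ∀ i → DecTotalOrder.totalOrder (strictTailAt ℤ-chain i) ≅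
                       DecTotalOrder.totalOrder ℕ-chain
strictTailAt-ℤ i = mk≅ (λ (j , _) → ∣ j ℤ.- 1+i ∣) g
  (λ x y x≤y → ℤₚ.drop‿+≤+ (subst₂ ℤ._≤_ (sym (abs x)) (sym (abs y))
                 (ℤₚ.+-monoˡ-≤ (ℤ.- 1+i) x≤y)))
  (λ _ _ k≤l → ℤₚ.+-monoʳ-≤ 1+i (ℤ.+≤+ k≤l))
  (λ k → cong ∣_∣ (trans (cong (ℤ._- 1+i) (ℤₚ.+-comm 1+i (+ k))) (cancelʳ (+ k) 1+i)))
  (λ x → trans (cong (λ z → 1+i ℤ.+ z) (abs x))
           (trans (ℤₚ.+-comm 1+i _) (cancel-+ (proj₁ x) 1+i)))
  where
  1+i = ℤ.suc i
  T = strictTailAt ℤ-chain i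

  cancelʳ : ∀ x y → (x ℤ.+ y) ℤ.- y ≡ x
  cancelʳ x y = trans (ℤₚ.+-assoc x y (ℤ.- y))
    (trans (cong (λ z → x ℤ.+ z) (ℤₚ.+-inverseʳ y)) (ℤₚ.+-identityʳ x))

  cancel-+ : ∀ x y → (x ℤ.- y) ℤ.+ y ≡ x
  cancel-+ x y = trans (ℤₚ.+-assoc x (ℤ.- y) y)
    (trans (cong (λ z → x ℤ.+ z) (ℤₚ.+-inverseˡ y)) (ℤₚ.+-identityʳ x))

  abs : (x : DecTotalOrder.Carrier T) → + ∣ proj₁ x ℤ.- 1+i ∣ ≡ proj₁ x ℤ.- 1+i
  abs (j , i≤j , i≢j) =
    ℤₚ.0≤i⇒+∣i∣≡i (ℤₚ.i≤j⇒0≤j-i (ℤₚ.i<j⇒suc[i]≤j (ℤₚ.≤∧≢⇒< i≤j i≢j)))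

  g : ℕ → DecTotalOrder.Carrier T
  g k = 1+i ℤ.+ + k , ℤₚ.<⇒≤ i<g , ℤₚ.<⇒≢ i<g
    where
    i<g : i ℤ.< 1+i ℤ.+ + k
    i<g = ℤₚ.suc[i]≤j⇒i<j (ℤₚ.i≤i+j 1+i (+ k))

tailAt-⊗ℕ : ∀ {A} x → tailAt (A ⊗ ℕ-chain) x ≅ tailAt A (proj₂ x) ⊕ A ⊗ ℕ-chain
tailAt-⊗ℕ (m , a) = ≅-trans (tailAt-⊗ ℕ-chain m a)
  (⊕-cong ≅-refl (⊗-cong (strictTailAt ℕ-chain m) ℕ-chain ≅-refl (strictTailAt-ℕ m)))

tailAt-⊗ℤ : ∀ {A} x → tailAt (A ⊗ ℤ-chain) x ≅ tailAt A (proj₂ x) ⊕ A ⊗ ℕ-chain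
tailAt-⊗ℤ (i , a) = ≅-trans (tailAt-⊗ ℤ-chain i a)
  (⊕-cong ≅-refl (⊗-cong (strictTailAt ℤ-chain i) ℕ-chain ≅-refl (strictTailAt-ℤ i)))

-- Families of chains indexed by the leaves of a tree

⌢-cong : ∀ {l r} {M M′ : Vector Chain l} {N N′ : Vector Chain r} →
         (∀ i → M i ≅ M′ i) → (∀ i → N i ≅ N′ i) → ∀ i → (M ⌢ N) i ≅ (M′ ⌢ N′) i
⌢-cong {l} e f i with splitAt l i
... | inj₁ j = e j
... | inj₂ j = f j

-- Leaves of t and of u with the same label carry isomorphic chains.  For
-- t = u = tree s 0 and M = N this is hypothesis (b).
record Coherent {l m} (t : Tree l) (M : Vector Chain l)
                      (u : Tree m) (N : Vector Chain m) : Set where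
  constructor coherent
  field
    sameLabel⇒≅ : ∀ i j → leafLabels t i ≡ leafLabels u j → M i ≅ N j
open Coherent

module _ {l m} {M : Vector Chain l} {u : Tree m} {N : Vector Chain m} where

  Coherent-sym : ∀ {t : Tree l} → Coherent t M u N → Coherent u N t M
  Coherent-sym c .sameLabel⇒≅ i j eq = ≅-sym (sameLabel⇒≅ c j i (sym eq))

  Coherent-unary : ∀ {t : Tree l} → Coherent (unary t) M u N → Coherent t M u N
  Coherent-unary c .sameLabel⇒≅ = sameLabel⇒≅ c

module _ {l r m} {t : Tree l} {t′ : Tree r} {M : Vector Chain (l ℕ.+ r)}
         {u : Tree m} {N : Vector Chain m} where

  Coherent-left : Coherent (binary t t′) M u N → Coherent t (take l M) u N
  Coherent-left c .sameLabel⇒≅ i j eq = sameLabel⇒≅ c (i ↑ˡ r) j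
    (trans (lookup-++ˡ (leafLabels t) (leafLabels t′) i) eq)

  Coherent-right : Coherent (binary t t′) M u N → Coherent t′ (drop l M) u N
  Coherent-right c .sameLabel⇒≅ i j eq = sameLabel⇒≅ c (l ↑ʳ i) j
    (trans (lookup-++ʳ (leafLabels t) (leafLabels t′) i) eq)

-- Restriction to subtrees of both trees, from a way of restricting the first
-- tree of a coherent pair.
both : ∀ {l l′ m m′} {t : Tree l} {t′ : Tree l′} {u : Tree m} {u′ : Tree m′}
       {M : Vector Chain l} {M′ : Vector Chain l′}
       {N : Vector Chain m} {N′ : Vector Chain m′} →
       (∀ {k} {v : Tree k} {K} → Coherent t M v K → Coherent t′ M′ v K) →
       (∀ {k} {v : Tree k} {K} → Coherent u N v K → Coherent u′ N′ v K) →
       Coherent t M u N → Coherent t′ M′ u′ N′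
both f g = Coherent-sym ∘ g ∘ Coherent-sym ∘ f

Coherent⇒pointwise : ∀ {l} {t : Tree l} {M N} → Coherent t M t N → ∀ i → M i ≅ N i
Coherent⇒pointwise c i = sameLabel⇒≅ c i i refl

-- The chains 𝒜 s M and their tails

𝒜-cong : ∀ {n} (s : 𝒮 (suc n)) {M N} → (∀ i → M i ≅ N i) → 𝒜 s M ≅ 𝒜 s N
𝒜-cong {zero} _ e = e zero
𝒜-cong {suc n} (s ▹ a ▹ b) with view b
... | ‵fromℕ     = λ e → ⊗-congˡ ℤ-chain (𝒜-cong (s ▹ a) e)
... | ‵inject₁ j = λ e →
  ⊕-cong (𝒜-cong (s ▹ j) (e ∘ (_↑ˡ ℓ (s ▹ a))))
         (⊗-congˡ ℕ-chain (𝒜-cong (s ▹ a) (e ∘ (ℓ (s ▹ j) ↑ʳ_))))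

-- 𝒜 (s ▹ a ▹ zero) at a concatenation, the form in which tail arrays occur.
𝒜-⌢ : ∀ {n} (s : 𝒮 n) (a : Fin (suc n)) (M : Vector Chain (ℓ (s ▹ zero))) N →
      𝒜 (s ▹ zero) M ⊕ 𝒜 (s ▹ a) N ⊗ ℕ-chain ≅ 𝒜 (s ▹ a ▹ zero) (M ⌢ N)
𝒜-⌢ s a M N = ⊕-cong
  (𝒜-cong (s ▹ zero) (λ i → ≅-reflexive (sym (lookup-++ˡ M N i))))
  (⊗-congˡ ℕ-chain (𝒜-cong (s ▹ a) (λ i → ≅-reflexive (sym (lookup-++ʳ M N i)))))

-- The tail arrays of sequences that differ only in their last entry agree
-- because both sides meet the same trees tree (s ▹ c) 0 off the leftmost path.
tailArray-cong : ∀ {n} (s : 𝒮 n) (a b : Fin (suc n)) (k l : ℕ)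
  (M : Vector Chain (ℓ (s ▹ a))) (U : ∀ i → Uniform (M i))
  (N : Vector Chain (ℓ (s ▹ b))) (V : ∀ i → Uniform (N i)) →
  (∀ i j → 𝐟 (U i) ≅ 𝐟 (V j)) →
  Coherent (tree (s ▹ a) k) M (tree (s ▹ b) l) N →
  ∀ i → tailArray (s ▹ a) M U i ≅ tailArray (s ▹ b) N V i
tailArray-cong ⟨⟩ _ _ _ _ _ _ _ _ tails _ _ = tails zero zero
tailArray-cong (s ▹ c) a b k l with view a | view b
... | ‵fromℕ | ‵fromℕ = λ M U N V tails c≅ → ⌢-cong
  (tailArray-cong s c c 0 0 M U N V tails (both Coherent-unary Coherent-unary c≅))
  (Coherent⇒pointwise (both Coherent-unary Coherent-unary c≅))
... | ‵fromℕ | ‵inject₁ j = λ M U N V tails c≅ → ⌢-cong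
  (tailArray-cong s c j 0 (suc l) M U _ (λ i → V (i ↑ˡ ℓ (s ▹ c)))
    (λ i i′ → tails i (i′ ↑ˡ _)) (both Coherent-unary Coherent-left c≅))
  (Coherent⇒pointwise (both Coherent-unary Coherent-right c≅))
... | ‵inject₁ i | ‵fromℕ = λ M U N V tails c≅ → ⌢-cong
  (tailArray-cong s i c (suc k) 0 _ (λ i′ → U (i′ ↑ˡ ℓ (s ▹ c))) N V
    (λ i′ → tails (i′ ↑ˡ _)) (both Coherent-left Coherent-unary c≅))
  (Coherent⇒pointwise (both Coherent-right Coherent-unary c≅))
... | ‵inject₁ i | ‵inject₁ j = λ M U N V tails c≅ → ⌢-cong
  (tailArray-cong s i j (suc k) (suc l)
    _ (λ i′ → U (i′ ↑ˡ ℓ (s ▹ c))) _ (λ i′ → V (i′ ↑ˡ ℓ (s ▹ c)))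
    (λ i′ j′ → tails (i′ ↑ˡ _) (j′ ↑ˡ _)) (both Coherent-left Coherent-left c≅))
  (Coherent⇒pointwise (both Coherent-right Coherent-right c≅))

-- An arbitrary element, needed because uniform chains carry a base point.
point : ∀ {n} (s : 𝒮 (suc n)) (M : Vector Chain (ℓ s)) →
        (∀ i → Uniform (M i)) → Carrier (𝒜 s M)
point {zero} _ M U = Uniform.base (U zero)
point {suc n} (s ▹ a ▹ b) with view b
... | ‵fromℕ     = λ M U → 0ℤ , point (s ▹ a) M U
... | ‵inject₁ j = λ M U → inj₁ (point (s ▹ j) _ (λ i → U (i ↑ˡ ℓ (s ▹ a))))

-- The theorem for all tails at once.  The root label k is arbitrary because
-- the left subtree is tree (s ▹ j) (suc k), not tree (s ▹ j) 0.
tailAt-𝒜 : ∀ {n} (s : 𝒮 (suc n)) (k : ℕ) (M : Vector Chain (ℓ s)) (U : ∀ i → Uniform (M i)) →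
  (∀ i j → 𝐟 (U i) ≅ 𝐟 (U j)) →
  Coherent (tree s k) M (tree s k) M →
  ∀ x → tailAt (𝒜 s M) x ≅ 𝒜 (𝐟ˢ s) (tailArray s M U)
tailAt-𝒜 {zero} (⟨⟩ ▹ _) k M U _ _ x = Uniform.equalTails (U zero) x (Uniform.base (U zero))
tailAt-𝒜 {suc n} (s ▹ a ▹ b) k with view b
... | ‵fromℕ = λ M U tails c x →
  ≅-trans (tailAt-⊗ℤ x) (≅-trans
    (⊕-cong (tailAt-𝒜 (s ▹ a) 0 M U tails (both Coherent-unary Coherent-unary c) (proj₂ x)) ≅-refl)
    (𝒜-⌢ s a (tailArray (s ▹ a) M U) M))
... | ‵inject₁ j = λ M U tails c →
  let M⁺ = take (ℓ (s ▹ j)) M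
      M⁻ = drop (ℓ (s ▹ j)) M
      U⁺ = λ i → U (i ↑ˡ ℓ (s ▹ a))
      U⁻ = λ i → U (ℓ (s ▹ j) ↑ʳ i)
      tail⁺ = tailAt-𝒜 (s ▹ j) (suc k) M⁺ U⁺ (λ i i′ → tails (i ↑ˡ _) (i′ ↑ˡ _))
                (both Coherent-left Coherent-left c)
      tail⁻ = tailAt-𝒜 (s ▹ a) 0 M⁻ U⁻ (λ i i′ → tails (_ ↑ʳ i) (_ ↑ʳ i′))
                (both Coherent-right Coherent-right c)
      arrays = tailArray-cong s a j 0 (suc k) M⁻ U⁻ M⁺ U⁺
                 (λ i i′ → tails (_ ↑ʳ i) (i′ ↑ˡ _)) (both Coherent-right Coherent-left c)
      result = 𝒜-⌢ s a (tailArray (s ▹ j) M⁺ U⁺) M⁻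
  in λ
  -- The right summand yields tails of 𝒜 (s ▹ a) in place of tails of 𝒜 (s ▹ j).
  { (inj₁ x) → ≅-trans (tailAt-⊕ˡ x) (≅-trans (⊕-cong (tail⁺ x) ≅-refl) result)
  ; (inj₂ y) → ≅-trans (tailAt-⊕ʳ y) (≅-trans (tailAt-⊗ℕ y) (≅-trans
      (⊕-cong (≅-trans (tail⁻ (proj₂ y)) (𝒜-cong (s ▹ zero) arrays)) ≅-refl) result))
  }

mainTheorem3 : ∀ (n : ℕ) (s : 𝒮 (suc n)) (M : Vector Chain (ℓ s)) (U : ∀ i → Uniform (M i)) →
    (∀ i → HasRankω (M i)) →
    (∀ i j → 𝐟 (U i) ≅ 𝐟 (U j)) →
    (∀ i j → wt s i ≡ wt s j → M i ≅ M j) →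
    Σ[ V ∈ Uniform (𝒜 s M) ] (𝐟 V ≅ 𝒜 (𝐟ˢ s) (tailArray s M U))
mainTheorem3 n s M U _ tails weights =
  record { base = point s M U ; equalTails = λ x y → ≅-trans (tail x) (≅-sym (tail y)) } ,
  tail (point s M U)
  where
  tail : ∀ x → tailAt (𝒜 s M) x ≅ 𝒜 (𝐟ˢ s) (tailArray s M U)
  tail = tailAt-𝒜 s 0 M U tails (coherent weights)
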